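{- There are infinitely many pairwise non-isomorphic 3-connected claw-free graphs $G$ for which there exist six distinct vertices $x_1,\dots,x_6$ and a seventh vertex $z\in V(G)\setminus\{x_1,\dots,x_6\}$ such that $G$ has no cycle containing all of $x_1,\dots,x_6$ and avoiding $z$.
   Context: Graphs are finite and simple. A graph is claw-free if it contains no induced subgraph isomorphic to $K_{1,3}$. -}

module Defs where

open import Data.Nat using (ℕ; _≤_; _<_)
open import Data.Fin using (Fin; zero; suc)
open import Data.Fin.Subset using (Subset; _∉_; ∣_∣)
open import Data.List using (List; _∷_; _∷ʳ_; length)
open import Data.List.Relation.Unary.Linked using (Linked)
open import Data.List.Relation.Unary.Unique.Propositional using (Unique)
open import Data.Product using (Σ; _×_; _,_)
open import Data.Unit using (⊤; tt)
open import Data.Empty using (⊥)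
open import Function.Bundles using (_↔_; _⇔_; module Inverse)
open import Function.Definitions using (Injective)
open import Level using (0ℓ)
open import Relation.Binary.Core using (Rel)
open import Relation.Binary.Construct.Closure.ReflexiveTransitive using (Star)
open import Relation.Binary.Definitions using (Decidable; Irreflexive; Symmetric)
open import Relation.Binary.PropositionalEquality using (_≡_; refl)
open import Relation.Nullary using (¬_; yes; no)

record Graph : Set₁ where
  field
    order  : ℕ
    Adj    : Rel (Fin order) 0ℓ
    adj?   : Decidable Adj
    sym    : Symmetric Adj
    irrefl : Irreflexive _≡_ Adj

  Vertex : Set
  Vertex = Fin order

open Graph public using (Vertex)
open Graph

infix 4 _≅_

_≅_ : Graph → Graph → Set
G ≅ H = Σ (Vertex G ↔ Vertex H) λ f →
  ∀ u v → Adj G u v ⇔ Adj H (Inverse.to f u) (Inverse.to f v)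

-- Some induced subgraph of G is isomorphic to H: the isomorphism is given as
-- a map into G whose image is the vertex set of that subgraph.
HasInduced : Graph → Graph → Set
HasInduced H G = Σ (Vertex H → Vertex G) λ f →
  Injective _≡_ _≡_ f × (∀ u v → Adj H u v ⇔ Adj G (f u) (f v))

-- K₁,₃, with centre zero.
claw : Graph
claw = record
  { order = 4 ; Adj = A ; adj? = A? ; sym = λ {u} {v} → A-sym u v
  ; irrefl = λ { {u} refl → A-irrefl u } }
  where
  A : Rel (Fin 4) 0ℓ
  A zero    (suc _) = ⊤
  A (suc _) zero    = ⊤
  A zero    zero    = ⊥
  A (suc _) (suc _) = ⊥

  A? : Decidable A
  A? zero    (suc _) = yes tt
  A? (suc _) zero    = yes tt
  A? zero    zero    = no λ ()
  A? (suc _) (suc _) = no λ ()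

  A-sym : ∀ u v → A u v → A v u
  A-sym zero    (suc _) _ = tt
  A-sym (suc _) zero    _ = tt

  A-irrefl : ∀ u → ¬ A u u
  A-irrefl zero    ()
  A-irrefl (suc _) ()

ClawFree : Graph → Set
ClawFree G = ¬ HasInduced claw G

-- Adjacency in G - X, as a relation on V(G).
AdjOutside : (G : Graph) → Subset (order G) → Rel (Vertex G) 0ℓ
AdjOutside G X u v = u ∉ X × v ∉ X × Adj G u v

-- G - X is connected; the reflexive-transitive closure is reachability by walks.
ConnectedOutside : (G : Graph) → Subset (order G) → Set
ConnectedOutside G X = ∀ u v → u ∉ X → v ∉ X → Star (AdjOutside G X) u v

-- |V(G)| > k, and deleting fewer than k vertices leaves a connected graph.
Connected[_] : ℕ → Graph → Set
Connected[ k ] G =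
  k < order G × (∀ (X : Subset (order G)) → ∣ X ∣ < k → ConnectedOutside G X)

-- The cycle start, rest₁, …, restₘ, start, of length m + 1 ≥ 3.
record Cycle (G : Graph) : Set where
  field
    start    : Vertex G
    rest     : List (Vertex G)
    length≥3 : 3 ≤ length (start ∷ rest)
    distinct : Unique (start ∷ rest)
    closed   : Linked (Adj G) (start ∷ (rest ∷ʳ start))

  vertices : List (Vertex G)
  vertices = start ∷ rest

open Cycle public using (vertices)

-- Let P be the Petersen graph, e = 05 one of its edges, and T the set consisting
-- of the ends of e and of the four nodes at distance two from e.  An exhaustive
-- search shows that no closed trail of P - e visits all of T.  Attach a pendant
-- edge at every node of T, and n more at node 0.  The line graph of the result is
-- claw-free, and 3-connected because P is 3-edge-connected.  A cycle avoiding the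
-- vertex e of the line graph induces a closed trail of P - e visiting the node of
-- every pendant edge on the cycle.

module Submission where

open import Data.Bool using (true)
open import Data.Bool.Properties using () renaming (_≟_ to _≟ᵇ_)
open import Data.Empty using (⊥; ⊥-elim)
open import Data.Fin using (Fin; zero; suc; #_; _≟_; _↑ˡ_; _↑ʳ_)
open import Data.Fin.Permutation using (↔⇒≡)
open import Data.Fin.Properties using (all?; any?; suc-injective; ↑ˡ-injective; ↑ʳ-injective)
open import Data.Fin.Subset using (Subset; inside; outside; ⁅_⁆; _∪_; ∣_∣)
  renaming (⊤ to full; _∈_ to _∈ˢ_; _∉_ to _∉ˢ_)
open import Data.Fin.Subset.Properties using (x∈⁅y⁆⇒x≡y; x∈p∪q⁻; _∈?_; ∈⊤)
open import Data.List using (List; []; _∷_; _∷ʳ_; allFin; concat; filter; foldr; length; map; replicate)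
open import Data.List.Membership.Propositional using (_∈_; _∉_)
open import Data.List.Membership.Propositional.Properties
  using (∈-allFin; ∈-filter⁺; ∈-++⁻; ∈-++⁺ˡ; ∈-++⁺ʳ; ∈-map⁺; ∈-map⁻; ∈-filter⁻)
open import Data.List.Properties using (length-map)
open import Data.List.Relation.Unary.All using (All; []; _∷_)
import Data.List.Relation.Unary.All as All
import Data.List.Relation.Unary.All.Properties as Allₚ
open import Data.List.Relation.Unary.AllPairs using ([]; _∷_)
open import Data.List.Relation.Unary.Any using (here; there)
open import Data.List.Relation.Unary.Linked using (Linked; [-]; _∷_)
open import Data.List.Relation.Unary.Unique.Propositional using (Unique)
import Data.List.Relation.Unary.Unique.Propositional.Properties as Uniqueₚ
open import Data.Nat using (ℕ; zero; suc; _+_; _<_; s≤s; z≤n)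
open import Data.Nat.Properties using (+-cancelʳ-≡; m≤n+m; ≤-trans)
open import Data.Product using (Σ; ∃; ∃₂; _×_; _,_; proj₁; proj₂)
open import Data.Sum using (_⊎_; inj₁; inj₂; [_,_]′)
import Data.Sum as Sum
open import Data.Unit using (tt)
open import Data.Vec using (Vec; []; _∷_; lookup; here; there)
import Data.Vec.Properties as Vecₚ
open import Function using (_∘_; case_of_)
open import Function.Bundles using (Equivalence)
open import Function.Definitions using (Injective)
open import Relation.Binary.Construct.Closure.ReflexiveTransitive using (Star; ε; _◅_; _◅◅_; reverse)
open import Relation.Binary.PropositionalEquality using (_≡_; _≢_; refl; sym; trans; cong; subst)
open import Relation.Nullary using (¬_; Dec; does; yes; no; ¬?; _×-dec_; _⊎-dec_; _→-dec_)
open import Relation.Nullary.Decidable using (map′)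
open import Defs

-- On the searches below, toWitness takes several times as long to check.
from-does : ∀ {P : Set} (P? : Dec P) → does P? ≡ true → P
from-does (yes p) _ = p

-- The Petersen graph with pendant edges

Node Line : Set
Node = Fin 10
Line = Fin 21

-- A pair of equal nodes encodes a pendant edge at that node.  The nodes 0–4
-- form the outer cycle of the Petersen graph and 5–9 its inner cycle.
ends : Vec (Node × Node) 21
ends =
    (# 0 , # 0) ∷ (# 5 , # 5) ∷ (# 2 , # 2) ∷ (# 3 , # 3) ∷ (# 6 , # 6) ∷ (# 9 , # 9)
  ∷ (# 0 , # 5) ∷ (# 1 , # 6) ∷ (# 2 , # 7) ∷ (# 3 , # 8) ∷ (# 4 , # 9)
  ∷ (# 0 , # 1) ∷ (# 1 , # 2) ∷ (# 2 , # 3) ∷ (# 3 , # 4) ∷ (# 4 , # 0)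
  ∷ (# 5 , # 7) ∷ (# 7 , # 9) ∷ (# 9 , # 6) ∷ (# 6 , # 8) ∷ (# 8 , # 5)
  ∷ []

end₁ end₂ : Line → Node
end₁ = proj₁ ∘ lookup ends
end₂ = proj₂ ∘ lookup ends

removed : Line
removed = # 6

pendant : Fin 6 → Line
pendant k = k ↑ˡ 15

-- These are the edges of the Petersen graph itself, as opposed to the pendant ones.
Proper : Line → Set
Proper l = end₁ l ≢ end₂ l

Proper? : ∀ l → Dec (Proper l)
Proper? l = ¬? (end₁ l ≟ end₂ l)

infix 4 _on_ _on?_

_on_ : Node → Line → Set
v on l = v ≡ end₁ l ⊎ v ≡ end₂ l

_on?_ : ∀ v l → Dec (v on l)
v on? l = v ≟ end₁ l ⊎-dec v ≟ end₂ l

two-ends⇒proper : ∀ {v w} l → v on l → w on l → w ≢ v → Proper l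
two-ends⇒proper l (inj₁ a) (inj₁ b) w≢v _ = w≢v (trans b (sym a))
two-ends⇒proper l (inj₁ a) (inj₂ b) w≢v e = w≢v (trans b (trans (sym e) (sym a)))
two-ends⇒proper l (inj₂ a) (inj₁ b) w≢v e = w≢v (trans b (trans e (sym a)))
two-ends⇒proper l (inj₂ a) (inj₂ b) w≢v _ = w≢v (trans b (sym a))

-- The line graphs, non-isomorphism and claw-freeness

Meet : Line → Line → Set
Meet k l = ∃ λ v → v on k × v on l

Meet? : ∀ k l → Dec (Meet k l)
Meet? k l = any? λ v → v on? k ×-dec v on? l

-- The n additional vertices all stand for further pendant edges at node 0.
line : ∀ n → Fin (n + 21) → Line
line zero    v       = v
line (suc n) zero    = zero
line (suc n) (suc v) = line n v

line-↑ʳ : ∀ n l → line n (n ↑ʳ l) ≡ l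
line-↑ʳ zero    l = refl
line-↑ʳ (suc n) l = line-↑ʳ n l

line-injective-on-proper : ∀ n u v → Proper (line n u) → line n u ≡ line n v → u ≡ v
line-injective-on-proper zero    u       v       _ eq = eq
line-injective-on-proper (suc n) zero    v       p _  = ⊥-elim (p refl)
line-injective-on-proper (suc n) (suc u) zero    p eq = ⊥-elim (subst Proper eq p refl)
line-injective-on-proper (suc n) (suc u) (suc v) p eq =
  cong suc (line-injective-on-proper n u v p eq)

G : ℕ → Graph
G n = record
  { order  = n + 21
  ; Adj    = λ u v → u ≢ v × Meet (line n u) (line n v)
  ; adj?   = λ u v → ¬? (u ≟ v) ×-dec Meet? (line n u) (line n v)
  ; sym    = λ (u≢v , w , wu , wv) → u≢v ∘ sym , w , wv , wu
  ; irrefl = λ u≡v (u≢v , _) → u≢v u≡v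
  }

G-pairwise-≇ : ∀ i j → i ≢ j → ¬ (G i ≅ G j)
G-pairwise-≇ i j i≢j (f , _) = i≢j (+-cancelʳ-≡ 21 i j (↔⇒≡ f))

-- Two of the three leaves of a claw would meet the centre in the same end.
clawFree : ∀ n → ClawFree (G n)
clawFree n (f , f-inj , f-adj) = pigeonhole (end (# 0)) (end (# 1)) (end (# 2))
  where
  centre : Line
  centre = line n (f zero)

  Leaf : Node → Fin 3 → Set
  Leaf w k = w on line n (f (suc k))

  end : ∀ k → Leaf (end₁ centre) k ⊎ Leaf (end₂ centre) k
  end k with Equivalence.to (f-adj zero (suc k)) tt
  ... | _ , _ , inj₁ refl , wl = inj₁ wl
  ... | _ , _ , inj₂ refl , wl = inj₂ wl

  apart : ∀ {w} j k → j ≢ k → Leaf w j → Leaf w k → ⊥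
  apart j k j≢k wj wk = Equivalence.from (f-adj (suc j) (suc k))
    ((λ eq → j≢k (suc-injective (f-inj eq))) , _ , wj , wk)

  pigeonhole : ∀ {v w} → Leaf v (# 0) ⊎ Leaf w (# 0) → Leaf v (# 1) ⊎ Leaf w (# 1) →
               Leaf v (# 2) ⊎ Leaf w (# 2) → ⊥
  pigeonhole (inj₁ a) (inj₁ b) _        = apart (# 0) (# 1) (λ ()) a b
  pigeonhole (inj₂ a) (inj₂ b) _        = apart (# 0) (# 1) (λ ()) a b
  pigeonhole (inj₁ a) (inj₂ b) (inj₁ c) = apart (# 0) (# 2) (λ ()) a c
  pigeonhole (inj₁ a) (inj₂ b) (inj₂ c) = apart (# 1) (# 2) (λ ()) b c
  pigeonhole (inj₂ a) (inj₁ b) (inj₁ c) = apart (# 1) (# 2) (λ ()) b c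
  pigeonhole (inj₂ a) (inj₁ b) (inj₂ c) = apart (# 0) (# 2) (λ ()) a c

-- 3-connectedness

elements : ∀ {n} (X : Subset n) →
           ∃ λ xs → length xs ≡ ∣ X ∣ × (∀ {x} → x ∈ˢ X → x ∈ xs)
elements [] = [] , refl , λ ()
elements (outside ∷ X) with elements X
... | xs , len , cover = map suc xs , trans (length-map suc xs) len ,
  λ { (there x∈X) → ∈-map⁺ suc (cover x∈X) }
elements (inside ∷ X) with elements X
... | xs , len , cover = zero ∷ map suc xs , cong suc (trans (length-map suc xs) len) ,
  λ { here → here refl ; (there x∈X) → there (∈-map⁺ suc (cover x∈X)) }

-- Enlarging `X` to a pair reduces connectedness to a finite check over pairs of lines. The vertex
-- `d` serves as both entries when `X` is empty.
∣X∣<3⇒X⊆pair : ∀ {n} → Fin n → (X : Subset n) → ∣ X ∣ < 3 →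
               ∃₂ λ a b → ∀ {x} → x ∈ˢ X → x ≡ a ⊎ x ≡ b
∣X∣<3⇒X⊆pair d X ∣X∣<3 with elements X
... | xs , len , cover with xs | subst (_< 3) (sym len) ∣X∣<3
...   | []           | _ = d , d , λ x∈X → case cover x∈X of λ ()
...   | a ∷ []       | _ = a , a , λ x∈X → case cover x∈X of λ { (here eq) → inj₁ eq }
...   | a ∷ b ∷ []   | _ = a , b , λ x∈X → case cover x∈X of
  λ { (here eq) → inj₁ eq ; (there (here eq)) → inj₂ eq }
...   | _ ∷ _ ∷ _ ∷ _ | s≤s (s≤s (s≤s ()))

Avoids : Line → Line → Line → Set
Avoids a b l = l ≢ a × l ≢ b

avoids? : ∀ a b l → Dec (Avoids a b l)
avoids? a b l = ¬? (l ≟ a) ×-dec ¬? (l ≟ b)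

absorb : Line → Subset 10 → Subset 10
absorb l S with end₁ l ∈? S ⊎-dec end₂ l ∈? S
... | yes _ = (⁅ end₁ l ⁆ ∪ ⁅ end₂ l ⁆) ∪ S
... | no  _ = S

-- With only two passes the sweep can miss a node.
passes : List Line
passes = concat (replicate 3 (allFin 21))

sweep : Line → Line → List Line
sweep a b = filter (avoids? a b) passes

-- A record rather than a synonym, so that conversion checking does not unfold the
-- sweep for variable a and b.
record Spans (a b : Line) : Set where
  constructor spans
  field
    sweep-full : foldr absorb ⁅ zero ⁆ (sweep a b) ≡ full

spans? : ∀ a b → Dec (Spans a b)
spans? a b = map′ spans Spans.sweep-full
  (Vecₚ.≡-dec _≟ᵇ_ (foldr absorb ⁅ zero ⁆ (sweep a b)) full)

abstract
  -- This is 3-edge-connectedness of the Petersen graph, checked on all pairs of lines, equal or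
  -- pendant ones included.
  sweep-spans : ∀ a b → Spans a b
  sweep-spans = from-does (all? λ a → all? λ b → spans? a b) refl

  line-avoiding : ∀ a b → ∃ λ l → Avoids a b l × zero on l
  line-avoiding = from-does (all? λ a → all? λ b → any? λ l → avoids? a b l ×-dec zero on? l) refl

connected : ∀ n → Connected[ 3 ] (G n)
connected n = ≤-trans (s≤s (s≤s (s≤s (s≤s z≤n)))) (m≤n+m 21 n) , connectedOutside
  where
  connectedOutside : ∀ X → ∣ X ∣ < 3 → ConnectedOutside (G n) X
  connectedOutside X ∣X∣<3 u v u∉X v∉X
    with a , b , X⊆ab ← ∣X∣<3⇒X⊆pair (n ↑ʳ zero) X ∣X∣<3 = walk
    where
    a′ b′ : Line
    a′ = line n a
    b′ = line n b

    infix 4 _⇝_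
    _⇝_ : Fin (n + 21) → Fin (n + 21) → Set
    _⇝_ = Star (AdjOutside (G n) X)

    alive : ∀ {l} → Avoids a′ b′ l → n ↑ʳ l ∉ˢ X
    alive {l} (l≢a , l≢b) l∈X = [ (λ eq → l≢a (trans (sym (line-↑ʳ n l)) (cong (line n) eq)))
                                , (λ eq → l≢b (trans (sym (line-↑ʳ n l)) (cong (line n) eq)))
                                ]′ (X⊆ab l∈X)

    meet : ∀ {w x y} → x ∉ˢ X → y ∉ˢ X → w on line n x → w on line n y → x ⇝ y
    meet {x = x} {y} x∉X y∉X wx wy with x ≟ y
    ... | yes refl = ε
    ... | no  x≢y  = (x∉X , y∉X , x≢y , _ , wx , wy) ◅ ε

    -- Quantifying over all surviving vertices at both nodes lets walks in the line graph be
    -- extended node by node in the Petersen graph.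
    Reached : Node → Set
    Reached w = ∀ {x y} → x ∉ˢ X → y ∉ˢ X → zero on line n x → w on line n y → x ⇝ y

    across : ∀ {l v w} → Avoids a′ b′ l → v on l → w on l → Reached v → Reached w
    across {l} ok vl wl reach x∉X y∉X 0x wy =
      reach x∉X (alive ok) 0x (subst (_ on_) (sym (line-↑ʳ n l)) vl) ◅◅
      meet (alive ok) y∉X (subst (_ on_) (sym (line-↑ʳ n l)) wl) wy

    absorb-reached : ∀ {l S} → Avoids a′ b′ l → (∀ {w} → w ∈ˢ S → Reached w) →
                     ∀ {w} → w ∈ˢ absorb l S → Reached w
    absorb-reached {l} {S} ok reach {w} w∈
      with end₁ l ∈? S ⊎-dec end₂ l ∈? S
    ... | no  _   = reach w∈
    ... | yes met with x∈p∪q⁻ _ S w∈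
    ...   | inj₂ w∈S   = reach w∈S
    ...   | inj₁ w∈end = [ across ok (inj₁ refl) wl ∘ reach , across ok (inj₂ refl) wl ∘ reach ]′ met
      where
      wl : w on l
      wl = Sum.map (x∈⁅y⁆⇒x≡y _) (x∈⁅y⁆⇒x≡y _) (x∈p∪q⁻ _ _ w∈end)

    sweep-reached : ∀ {ls} → All (Avoids a′ b′) ls →
                    ∀ {w} → w ∈ˢ foldr absorb ⁅ zero ⁆ ls → Reached w
    -- Any two surviving vertices at node 0 are equal or adjacent.
    sweep-reached []         w∈ with refl ← x∈⁅y⁆⇒x≡y zero w∈ = meet
    sweep-reached (ok ∷ oks) = absorb-reached ok (sweep-reached oks)

    reached : ∀ w → Reached w
    reached w = sweep-reached {sweep a′ b′} (Allₚ.all-filter (avoids? a′ b′) passes)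
      (subst (w ∈ˢ_) (sym (Spans.sweep-full (sweep-spans a′ b′))) ∈⊤)

    fromHub : ∃ λ h → ∀ {y} → y ∉ˢ X → h ⇝ y
    fromHub = let l , ok , 0l = line-avoiding a′ b′ in
      n ↑ʳ l , λ y∉X →
        reached _ (alive ok) y∉X (subst (_ on_) (sym (line-↑ʳ n l)) 0l) (inj₁ refl)

    walk : u ⇝ v
    walk = reverse (λ (x∉X , y∉X , x~y) → y∉X , x∉X , Graph.sym (G n) x~y) (proj₂ fromHub u∉X) ◅◅
           proj₂ fromHub v∉X

-- Exhaustive search for closed trails

-- Stuck k A N t v: no trail from v to t along lines of A visits all of N; its
-- derivation, of depth at most k, is the tree of all trails from v.
data Stuck : ℕ → List Line → List Node → Node → Node → Set where
  stuck : ∀ {k A N t v} →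
    ¬ (t ≡ v × All (_≡ v) N) →
    All (λ l → (v ≡ end₁ l → Stuck k (filter (¬? ∘ (_≟ l)) A) (filter (¬? ∘ (_≟ v)) N) t (end₂ l)) ×
               (v ≡ end₂ l → Stuck k (filter (¬? ∘ (_≟ l)) A) (filter (¬? ∘ (_≟ v)) N) t (end₁ l))) A →
    Stuck (suc k) A N t v

stuck? : ∀ k A N t v → Dec (Stuck k A N t v)
stuck? zero    A N t v = no λ ()
stuck? (suc k) A N t v = map′ (λ (x , y) → stuck x y) (λ { (stuck x y) → x , y })
  (¬? (t ≟ v ×-dec All.all? (_≟ v) N) ×-dec
   All.all? (λ l → (v ≟ end₁ l →-dec stuck? k _ _ t (end₂ l)) ×-dec
                   (v ≟ end₂ l →-dec stuck? k _ _ t (end₁ l))) A)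

available : List Line
available = filter (λ l → Proper? l ×-dec ¬? (l ≟ removed)) (allFin 21)

terminals : List Node
terminals = map (end₁ ∘ pendant) (allFin 6)

abstract
  -- At most 14 lines can be crossed, one fewer than the Petersen graph has, so depth 15 suffices.
  all-stuck : ∀ v → Stuck 15 available terminals v v
  all-stuck = from-does (all? λ v → stuck? 15 available terminals v v) refl

proper⇒available : ∀ l → Proper l → l ≢ removed → l ∈ available
proper⇒available l p l≢r =
  ∈-filter⁺ (λ l → Proper? l ×-dec ¬? (l ≟ removed)) (∈-allFin l) (p , l≢r)

pendant-ends : ∀ k {v} → v on pendant k → end₁ (pendant k) ≡ v
pendant-ends k = [ sym , (λ eq → trans (pendant-proper k) (sym eq)) ]′
  where
  pendant-proper : ∀ k → end₁ (pendant k) ≡ end₂ (pendant k)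
  pendant-proper = from-does (all? λ k → end₁ (pendant k) ≟ end₂ (pendant k)) refl

-- From cycles of the line graph to closed trails

module Trails (n : ℕ) where

  private
    V : Set
    V = Fin (n + 21)

  -- A line on the list need not be crossed: v and w may be equal.
  data Trail : Node → List V → Node → Set where
    []  : ∀ {v} → Trail v [] v
    _∷_ : ∀ {v w t x xs} → (v on line n x × w on line n x) → Trail w xs t → Trail v (x ∷ xs) t

  visited : ∀ {v xs t} → Trail v xs t → List Node
  visited {v} []      = v ∷ []
  visited {v} (_ ∷ r) = v ∷ visited r

  -- Both ends of a pendant line are the same node, so a trail listing that line must stand there.
  visited-terminal : ∀ k {v xs t} (r : Trail v xs t) →
                     n ↑ʳ pendant k ∈ xs → end₁ (pendant k) ∈ visited r
  visited-terminal k ((vx , _) ∷ _) (here refl) =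
    here (pendant-ends k (subst (_ on_) (line-↑ʳ n (pendant k)) vx))
  visited-terminal k (_ ∷ r) (there x∈) = there (visited-terminal k r x∈)

  -- A common end is chosen for each adjacent pair; each vertex of `ys` then leads from the end
  -- shared with its predecessor to the end shared with its successor.
  linked⇒trail : ∀ {x} ys {z} → Linked (Graph.Adj (G n)) (x ∷ (ys ∷ʳ z)) →
                 ∃₂ λ v w → v on line n x × w on line n z × Trail v ys w
  linked⇒trail []       ((_ , v , vx , vz) ∷ [-]) = v , v , vx , vz , []
  linked⇒trail (y ∷ ys) ((_ , v , vx , vy) ∷ xs)
    with u , w , uy , wz , r ← linked⇒trail ys xs = v , w , vx , wz , (vy , uy) ∷ r

  _∷ʳᵗ_ : ∀ {v w t x xs} → Trail v xs w → w on line n x × t on line n x → Trail v (xs ∷ʳ x) t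
  []      ∷ʳᵗ e = e ∷ []
  (d ∷ r) ∷ʳᵗ e = d ∷ (r ∷ʳᵗ e)

  -- Induction on the trail: a line that is crossed selects a branch of the search tree, while one
  -- that is not crossed leaves the derivation as it is.
  stuck⇒no-trail : ∀ {k A N t v xs} → Stuck k A N t v → Unique xs →
    (∀ {x} → x ∈ xs → Proper (line n x) → line n x ∈ A) →
    (r : Trail v xs t) → ¬ (∀ {m} → m ∈ N → m ∈ visited r)
  -- The final node may still be in `N`, since nodes are struck out only on departure.
  stuck⇒no-trail (stuck ¬done _) _ _ [] N⊆ =
    ¬done (refl , All.tabulate λ m∈N → ∈[v] (N⊆ m∈N))
    where
    ∈[v] : ∀ {m v : Node} → m ∈ v ∷ [] → m ≡ v
    ∈[v] (here eq) = eq
  stuck⇒no-trail {k} {A} {N} {t} {v} {x ∷ xs} s@(stuck _ next) (x∉xs ∷ xs!) avail (_∷_ {w = w} (vx , wx) r) N⊆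
    with w ≟ v
  ... | yes refl = stuck⇒no-trail s xs! (avail ∘ there) r (λ m∈N → merge r (N⊆ m∈N))
    where
    merge : ∀ {m v xs} (r : Trail v xs t) → m ∈ v ∷ visited r → m ∈ visited r
    merge []      (here eq) = here eq
    merge (_ ∷ _) (here eq) = here eq
    merge _       (there m∈) = m∈
  ... | no w≢v = stuck⇒no-trail (move vx wx) xs! avail′ r N⊆′
    where
    x-proper : Proper (line n x)
    x-proper = two-ends⇒proper (line n x) vx wx w≢v

    move : v on line n x → w on line n x →
           Stuck _ (filter (¬? ∘ (_≟ line n x)) A) (filter (¬? ∘ (_≟ v)) N) t w
    move (inj₁ a) (inj₁ b) = ⊥-elim (w≢v (trans b (sym a)))
    move (inj₁ a) (inj₂ refl) = proj₁ (All.lookup next (avail (here refl) x-proper)) a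
    move (inj₂ a) (inj₁ refl) = proj₂ (All.lookup next (avail (here refl) x-proper)) a
    move (inj₂ a) (inj₂ b) = ⊥-elim (w≢v (trans b (sym a)))

    avail′ : ∀ {y} → y ∈ xs → Proper (line n y) → line n y ∈ filter (¬? ∘ (_≟ line n x)) A
    avail′ {y} y∈xs p = ∈-filter⁺ (¬? ∘ (_≟ line n x)) (avail (there y∈xs) p)
      λ eq → All.lookup x∉xs y∈xs (sym (line-injective-on-proper n y x p eq))

    N⊆′ : ∀ {m} → m ∈ filter (¬? ∘ (_≟ v)) N → m ∈ visited r
    N⊆′ m∈ with m∈N , m≢v ← ∈-filter⁻ (¬? ∘ (_≟ v)) m∈ with N⊆ m∈N
    ... | here eq  = ⊥-elim (m≢v eq)
    ... | there m∈r = m∈r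

  terminal : Fin 6 → V
  terminal k = n ↑ʳ pendant k

  no-cycle : ¬ (Σ (Cycle (G n)) λ C →
                  (∀ k → terminal k ∈ vertices C) × n ↑ʳ removed ∉ vertices C)
  no-cycle (C , terminal∈ , removed∉)
    -- The trail through `rest` runs from `v` to `w`, both ends of the line of `start`; appending
    -- `start` closes it at `v`.
    with v , w , vs , ws , r ← linked⇒trail (Cycle.rest C) (Cycle.closed C) =
    stuck⇒no-trail (all-stuck v) unique avail (r ∷ʳᵗ (ws , vs)) N⊆
    where
    open Cycle C using (start; rest; distinct)

    rotate : ∀ {x} → x ∈ start ∷ rest → x ∈ rest ∷ʳ start
    rotate (here eq)  = ∈-++⁺ʳ rest (here eq)
    rotate (there x∈) = ∈-++⁺ˡ x∈

    unrotate : ∀ {x} → x ∈ rest ∷ʳ start → x ∈ start ∷ rest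
    unrotate x∈ with ∈-++⁻ rest x∈
    ... | inj₁ x∈rest    = there x∈rest
    ... | inj₂ (here eq) = here eq

    unique : Unique (rest ∷ʳ start)
    unique with start∉rest ∷ rest! ← distinct = Uniqueₚ.++⁺ rest! ([] ∷ [])
      λ { (x∈rest , here refl) → All.lookup start∉rest x∈rest refl }

    avail : ∀ {x} → x ∈ rest ∷ʳ start → Proper (line n x) → line n x ∈ available
    -- The removed edge is proper, so only the avoided vertex lies over it.
    avail {x} x∈ p = proper⇒available (line n x) p λ eq → removed∉
      (subst (_∈ vertices C)
        (line-injective-on-proper n x (n ↑ʳ removed) p (trans eq (sym (line-↑ʳ n removed)))) (unrotate x∈))

    N⊆ : ∀ {m} → m ∈ terminals → m ∈ visited (r ∷ʳᵗ (ws , vs))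
    N⊆ m∈ with k , _ , refl ← ∈-map⁻ (end₁ ∘ pendant) {xs = allFin 6} m∈ =
      visited-terminal k _ (rotate (terminal∈ k))

mainTheorem6 : Σ (ℕ → Graph) λ G →
    (∀ i j → i ≢ j → ¬ (G i ≅ G j)) ×
    (∀ i →
    Connected[ 3 ] (G i) ×
    ClawFree (G i) ×
    (Σ (Fin 6 → Vertex (G i)) λ x →
    Σ (Vertex (G i)) λ z →
    Injective _≡_ _≡_ x ×
    (∀ k → z ≢ x k) ×
    ¬ (Σ (Cycle (G i)) λ C →
    (∀ k → x k ∈ vertices C) × z ∉ vertices C)))
mainTheorem6 = G , G-pairwise-≇ , λ n →
  connected n , clawFree n , Trails.terminal n , n ↑ʳ removed ,
  (λ eq → ↑ˡ-injective 15 _ _ (↑ʳ-injective n _ _ eq)) ,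
  (λ k eq → removed≢pendant k (↑ʳ-injective n _ _ eq)) ,
  Trails.no-cycle n
  where
  removed≢pendant : ∀ k → removed ≢ pendant k
  removed≢pendant = from-does (all? λ k → ¬? (removed ≟ pendant k)) refl
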